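{- Let $G$ be a planar triangulation with planar dual $G^*$. Suppose that each vertex of $G$ is coloured either blue or red (the colouring is not required to be proper) such that: (i) every face of $G$ is incident to at least one blue vertex; (ii) there is no cycle of $G$ all of whose vertices are blue; and (iii) every cycle of $G$ all of whose vertices are red contains a vertex whose degree in $G$ is at most $4$. Then $G^*$ is Hamiltonian, that is, $G^*$ has a cycle passing through every vertex of $G^*$.
   Context: A planar triangulation is a finite simple graph with at least $4$ vertices, embedded in the plane (equivalently the sphere), in which every face, including the outer face, is bounded by a $3$-cycle. Its planar dual $G^*$ has one vertex for each face of $G$ (including the outer face), and for each edge $e$ of $G$ an edge joining the two faces incident to $e$; it is a cubic $3$-connected planar graph. "Cycle of $G$" means any cycle in $G$ as a subgraph (not necessarily induced or facial). -}

module Defs where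

open import Data.Nat using (ℕ; _+_; _*_; _≤_)
open import Data.Nat.GeneralisedArithmetic using (iterate)
open import Data.Fin using (Fin)
open import Data.Fin.Properties using (_≟_)
open import Data.Fin.Permutation using (Permutation′; _⟨$⟩ʳ_)
open import Data.List using (List; _∷_; []; _∷ʳ_; length; filter; allFin)
open import Data.List.Membership.Propositional using (_∈_)
open import Data.List.Relation.Unary.Linked using (Linked)
open import Data.List.Relation.Unary.Unique.Propositional using (Unique)
open import Data.Product using (_×_; ∃; ∃-syntax)
open import Function.Bundles using (_⇔_)
open import Function.Definitions using (StrictlySurjective)
open import Relation.Binary.Construct.Closure.ReflexiveTransitive using (Star)
open import Relation.Binary.PropositionalEquality using (_≡_; _≢_)

-- A finite undirected graph, a priori with loops and parallel edges.  Every
-- edge consists of two opposite darts, exchanged by rev; hence 2 * #E darts.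
record Graph : Set where
  field
    #V #E : ℕ

  Vertex : Set
  Vertex = Fin #V

  Dart : Set
  Dart = Fin (2 * #E)

  field
    src            : Dart → Vertex
    rev            : Dart → Dart
    rev-involutive : ∀ a → rev (rev a) ≡ a
    rev-≢          : ∀ a → rev a ≢ a

  tgt : Dart → Vertex
  tgt a = src (rev a)

  Adj : Vertex → Vertex → Set
  Adj u v = ∃[ a ] (src a ≡ u × tgt a ≡ v)

  degree : Vertex → ℕ
  degree v = length (filter (λ a → src a ≟ v) (allFin (2 * #E)))

  Connected : Set
  Connected = ∀ u v → Star Adj u v

  record Simple : Set where
    field
      no-loops    : ∀ a → src a ≢ tgt a
      no-parallel : ∀ a b → src a ≡ src b → tgt a ≡ tgt b → a ≡ b

  -- The vertices are listed in cyclic order, without repeating the first one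
  -- at the end.  In a multigraph this leaves out the cycles of length 1 and 2.
  record IsCycle (start : Vertex) (rest : List Vertex) : Set where
    field
      long     : 3 ≤ length (start ∷ rest)
      distinct : Unique (start ∷ rest)
      closed   : Linked Adj (start ∷ rest ∷ʳ start)

  record Cycle : Set where
    field
      start   : Vertex
      rest    : List Vertex
      isCycle : IsCycle start rest

    vertices : List Vertex
    vertices = start ∷ rest

  Hamiltonian : Set
  Hamiltonian = ∃[ C ] (∀ v → v ∈ Cycle.vertices C)

SameOrbit : {A : Set} → (A → A) → A → A → Set
SameOrbit f x y = ∃[ k ] iterate f x k ≡ y

-- An embedding of a graph in an oriented closed surface with all faces open
-- discs, given by its rotation system: rot takes a dart to the next dart
-- clockwise around the same source.  The boundary walk of the face to the left
-- of a then continues, at the target of a, with the dart following rev a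
-- clockwise.
record Embedding (G : Graph) : Set where
  open Graph G

  field
    rot        : Permutation′ (2 * #E)
    src-orbits : ∀ a b → src a ≡ src b ⇔ SameOrbit (rot ⟨$⟩ʳ_) a b

  next : Dart → Dart
  next a = rot ⟨$⟩ʳ rev a

  field
    #F : ℕ

  Face : Set
  Face = Fin #F

  field
    left            : Dart → Face
    left-surjective : StrictlySurjective _≡_ left
    left-orbits     : ∀ a b → left a ≡ left b ⇔ SameOrbit next a b

  Incident : Vertex → Face → Set
  Incident v f = ∃[ a ] (left a ≡ f × src a ≡ v)

  -- For connected G: the surface is the sphere.
  GenusZero : Set
  GenusZero = #V + #F ≡ #E + 2

  -- The face to the left of a is bounded by a 3-cycle.
  BoundedBy3Cycle : Dart → Set
  BoundedBy3Cycle a =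
    IsCycle (src a) (src (next a) ∷ src (next (next a)) ∷ []) ×
    next (next (next a)) ≡ a

  -- The dart dual to a crosses a from its left to its right.
  dual : Graph
  dual = record
    { #V             = #F
    ; #E             = #E
    ; src            = left
    ; rev            = rev
    ; rev-involutive = rev-involutive
    ; rev-≢          = rev-≢
    }

record PlanarTriangulation : Set where
  field
    graph     : Graph
    embedding : Embedding graph

  open Graph graph public
  open Embedding embedding public

  field
    simple       : Simple
    4≤#V         : 4 ≤ #V
    connected    : Connected
    genusZero    : GenusZero
    triangulated : ∀ a → BoundedBy3Cycle a

data Colour : Set where
  blue red : Colour

{-# OPTIONS --safe #-}
module Submission where

-- If the red vertices induce a forest too, then the dual curve between red and blue
-- is a Hamiltonian cycle: for the indicator Ψ of the faces on one of its components,
-- the boundary ∂ Ψ is a flow that lives on monochromatic edges, hence vanishes, so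
-- that Ψ is constant.  Otherwise the red part W of some ∂ Ψ is a nonzero flow, and its
-- support contains a red cycle, hence a red vertex v of degree at most 4.  As no face
-- is red, v has exactly four neighbours, alternately red and blue, and v is recoloured
-- blue.  A blue cycle arising in this way would pass through v between the two red
-- neighbours, and would cross the red flow W exactly once.  This is impossible on
-- the sphere: a flow Z has n Z = - ∂ Φ for some n ≠ 0 and some potential Φ on the
-- faces, and Φ would take different values on the two sides of the blue cycle, while
-- the balance of W forces them to agree.

open import Defs
open import Data.Nat using (_≤_)
open import Data.List.Relation.Unary.All using (All)
open import Data.List.Relation.Unary.Any using (Any)
open import Data.Product using (_×_; ∃-syntax)
open import Relation.Binary.PropositionalEquality using (_≡_)
open import Relation.Nullary using (¬_)

open import Data.Bool using (Bool)
open import Data.Fin as Fin using (Fin; zero; suc; _↑ˡ_; _↑ʳ_; punchIn; toℕ; fromℕ<)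
open import Data.Fin.Permutation using (_⟨$⟩ʳ_; _⟨$⟩ˡ_; inverseˡ; permutation)
import Data.Fin.Properties as Fin
open import Data.Fin.Subset using (Subset; inside; outside; _⊂_) renaming (_∈_ to _∈ˢ_)
open import Data.Fin.Subset.Induction using (⊂-wellFounded)
open import Data.Integer as ℤ using (ℤ; -[1+_]; +≤+; 0ℤ; 1ℤ; _+_; _*_; -_; _-_) renaming (+_ to pos)
import Data.Integer.Properties as ℤ
open import Data.Integer.Tactic.RingSolver using (solve-∀)
open import Data.List using (List; []; _∷_; _∷ʳ_; length; lookup; map; filter; allFin; applyUpTo) renaming (_++_ to _++ᴸ_)
open import Data.List.Membership.Propositional using (_∈_; find)
open import Data.List.Membership.Propositional.Properties
  using (∈-lookup; ∈-filter⁺; ∈-filter⁻; ∈-allFin; ∈-map⁻; ∈-applyUpTo⁺; ∈-applyUpTo⁻)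
import Data.List.Membership.Setoid.Properties as Membership
open import Data.List.Properties using (length-map; length-++; length-tabulate; length-applyUpTo; applyUpTo-∷ʳ)
open import Data.List.Relation.Binary.Subset.Propositional using (_⊆_)
open import Data.List.Relation.Unary.All as All using ([]; _∷_)
open import Data.List.Relation.Unary.All.Properties using (¬Any⇒All¬)
open import Data.List.Relation.Unary.AllPairs using ([]; _∷_)
open import Data.List.Relation.Unary.Any as Any using (index; here; there)
open import Data.List.Relation.Unary.Any.Properties using (lookup-index)
open import Data.List.Relation.Unary.Linked using (Linked)
import Data.List.Relation.Unary.Linked.Properties as Linked
open import Data.List.Relation.Unary.Unique.Propositional using (Unique)
import Data.List.Relation.Unary.Unique.Propositional.Properties as Unique
open import Data.Nat as ℕ using (ℕ; zero; suc; _<_; z≤n; s≤s; s<s; z<s)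
open import Data.Nat.GeneralisedArithmetic using (iterate)
open import Data.Nat.Induction using (<-rec)
import Data.Nat.Properties as ℕ
open import Data.Product using (Σ; _,_; ∃₂; proj₁; proj₂)
open import Data.Sum using (_⊎_; inj₁; inj₂; [_,_]′)
import Data.Vec as Vec
open import Data.Vec.Functional using (Vector; insertAt; removeAt; _++_) renaming (_∷_ to _∷ᵛ_)
open import Data.Vec.Functional.Properties using (insertAt-lookup; insertAt-punchIn; lookup-++ˡ; lookup-++ʳ)
import Data.Vec.Properties as Vec
open import Function using (_∘_; id)
open import Function.Bundles using (Equivalence)
open import Induction.WellFounded using (Acc; acc)
open import Relation.Binary.Construct.Closure.ReflexiveTransitive using (Star; ε; _◅_)
open import Relation.Binary.Definitions using (Tri; tri<; tri≈; tri>)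
open import Relation.Binary.PropositionalEquality
open import Relation.Nullary using (Dec; yes; no; contradiction; ¬?; _×-dec_; decidable-stable)

open import Algebra.Properties.Semiring.Sum ℤ.+-*-semiring
  using (sum; sum-cong-≗; ∑-distrib-+; sum-remove; sum-permute; *-distribˡ-sum)

-- Lists without repetitions, and finite sums of integers.

unique⇒lookup-≢ : ∀ {A : Set} {xs : List A} → Unique xs → ∀ {i j} → i Fin.< j → lookup xs i ≢ lookup xs j
unique⇒lookup-≢ (x≢ ∷ _)  {zero}  {suc j} _         = All.lookup x≢ (∈-lookup j)
unique⇒lookup-≢ (_ ∷ xs!) {suc i} {suc j} (s<s i<j) = unique⇒lookup-≢ xs! i<j

unique-⊆⇒length≤ : ∀ {A : Set} {xs ys : List A} → Unique xs → xs ⊆ ys → length xs ≤ length ys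
unique-⊆⇒length≤ {xs = xs} {ys} xs! xs⊆ys with length ys ℕ.<? length xs
... | no  ys≮xs = ℕ.≮⇒≥ ys≮xs
... | yes ys<xs =
  let f = λ i → index (xs⊆ys (∈-lookup {xs = xs} i))
      i , j , i<j , fi≡fj = Fin.pigeonhole ys<xs f
  in contradiction (Membership.index-injective (setoid _) _ _ fi≡fj) (unique⇒lookup-≢ xs! i<j)

sum-zero : ∀ {n} {t : Vector ℤ n} → (∀ i → t i ≡ 0ℤ) → sum t ≡ 0ℤ
sum-zero {zero}  t≡0 = refl
sum-zero {suc n} t≡0 = cong₂ _+_ (t≡0 zero) (sum-zero (t≡0 ∘ suc))

sum-single : ∀ {n} {t : Vector ℤ n} i → (∀ j → j ≢ i → t j ≡ 0ℤ) → sum t ≡ t i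
sum-single {suc n} {t} i others = begin
  sum t                      ≡⟨ sum-remove {i = i} t ⟩
  t i + sum (removeAt t i)   ≡⟨ cong (t i +_) (sum-zero (λ k → others (punchIn i k) (Fin.punchInᵢ≢i i k))) ⟩
  t i + 0ℤ                   ≡⟨ ℤ.+-identityʳ _ ⟩
  t i                        ∎
  where open ≡-Reasoning

sum-↑ : ∀ m {n} (t : Vector ℤ (m ℕ.+ n)) → sum t ≡ sum (λ i → t (i ↑ˡ n)) + sum (λ j → t (m ↑ʳ j))
sum-↑ zero    t = sym (ℤ.+-identityˡ _)
sum-↑ (suc m) t = trans (cong (t zero +_) (sum-↑ m (t ∘ suc))) (sym (ℤ.+-assoc (t zero) _ _))

sum-nonneg-zero : ∀ {n} {t : Vector ℤ n} → (∀ i → 0ℤ ℤ.≤ t i) → sum t ≡ 0ℤ → ∀ i → t i ≡ 0ℤ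
sum-nonneg-zero {suc n} {t} 0≤t sum≡0 i =
  ℤ.≤-antisym (subst (t i ℤ.≤_) (trans (sym (sum-remove {i = i} t)) sum≡0)
                (subst (ℤ._≤ t i + sum (removeAt t i)) (ℤ.+-identityʳ (t i)) (ℤ.+-monoʳ-≤ (t i) (nonneg (removeAt t i) (λ _ → 0≤t _)))))
              (0≤t i)
  where
  nonneg : ∀ {n} (t : Vector ℤ n) → (∀ i → 0ℤ ℤ.≤ t i) → 0ℤ ℤ.≤ sum t
  nonneg {zero}  t 0≤t = ℤ.≤-refl
  nonneg {suc n} t 0≤t = ℤ.+-mono-≤ (0≤t zero) (nonneg (t ∘ suc) (0≤t ∘ suc))

*-nonzero : ∀ {i j} → i ≢ 0ℤ → j ≢ 0ℤ → i * j ≢ 0ℤ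
*-nonzero {i} i≢0 j≢0 ij≡0 = [ i≢0 , j≢0 ]′ (ℤ.i*j≡0⇒i≡0∨j≡0 i ij≡0)

-- Homogeneous linear systems over the integers.

dot : ∀ {n} → Vector ℤ n → Vector ℤ n → ℤ
dot e x = sum (λ i → e i * x i)

dot-++ : ∀ {m n} (d : Vector ℤ m) (e : Vector ℤ n) (x : Vector ℤ (m ℕ.+ n)) →
         dot (d ++ e) x ≡ dot d (λ i → x (i ↑ˡ n)) + dot e (λ j → x (m ↑ʳ j))
dot-++ {m} {n} d e x = trans (sum-↑ m _) (cong₂ _+_
  (sum-cong-≗ (λ i → cong (_* x (i ↑ˡ n)) (lookup-++ˡ d e i)))
  (sum-cong-≗ (λ j → cong (_* x (m ↑ʳ j)) (lookup-++ʳ d e j))))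

-- One step of Gaussian elimination without division: `eliminate` clears column `j` by
-- cross-multiplication, and `extend` scales a solution of the reduced system by `e j`, so that the
-- value at `j` forced by the equation `e` is an integer.
module Pivot {n} (e : Vector ℤ (suc n)) (j : Fin (suc n)) where

  eliminate : Vector ℤ (suc n) → Vector ℤ n
  eliminate d k = e j * d (punchIn j k) - d j * e (punchIn j k)

  extend : Vector ℤ n → Vector ℤ (suc n)
  extend x = insertAt (λ k → e j * x k) j (- dot (removeAt e j) x)

  dot-extend : ∀ d x → dot d (extend x) ≡ dot (eliminate d) x
  dot-extend d x = begin
    dot d (extend x)
      ≡⟨ sum-remove {i = j} (λ i → d i * extend x i) ⟩
    d j * extend x j + sum (λ k → d (punchIn j k) * extend x (punchIn j k))
      ≡⟨ cong₂ _+_ (cong (d j *_) (insertAt-lookup (λ k → e j * x k) j _))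
                   (sum-cong-≗ (λ k → cong (d (punchIn j k) *_) (insertAt-punchIn (λ k → e j * x k) j _ k))) ⟩
    d j * - dot (removeAt e j) x + sum (λ k → d (punchIn j k) * (e j * x k))
      ≡⟨ cong (_+ sum (λ k → d (punchIn j k) * (e j * x k)))
               (trans (shift (d j) (dot (removeAt e j) x)) (*-distribˡ-sum (- d j) (λ k → e (punchIn j k) * x k))) ⟩
    sum (λ k → - d j * (e (punchIn j k) * x k)) + sum (λ k → d (punchIn j k) * (e j * x k))
      ≡⟨ ∑-distrib-+ (λ k → - d j * (e (punchIn j k) * x k)) _ ⟨
    sum (λ k → - d j * (e (punchIn j k) * x k) + d (punchIn j k) * (e j * x k))
      ≡⟨ sum-cong-≗ (λ k → collect (d j) (e (punchIn j k)) (x k) (d (punchIn j k)) (e j)) ⟩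
    dot (eliminate d) x ∎
    where
    open ≡-Reasoning
    shift : ∀ a b → a * - b ≡ - a * b
    shift = solve-∀
    collect : ∀ a b c d e → - a * (b * c) + d * (e * c) ≡ (e * d - a * b) * c
    collect = solve-∀

-- Induction on the equations: a zero first equation is dropped with all unknowns kept; otherwise a
-- nonzero coefficient of it eliminates one unknown. The solution stays nonzero because `extend`
-- multiplies by that coefficient.
underdetermined : ∀ {m n} → m < n → (es : Fin m → Vector ℤ n) →
                  ∃[ x ] (∃[ i ] x i ≢ 0ℤ) × (∀ k → dot (es k) x ≡ 0ℤ)
underdetermined {zero}  {suc n} _         es = (λ _ → 1ℤ) , (zero , λ ()) , λ ()
underdetermined {suc m} {suc n} (s<s m<n) es with Fin.any? (λ j → ¬? (es zero j ℤ.≟ 0ℤ))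
... | no  e≡0 =
  let x , x≢0 , es·x≡0 = underdetermined (ℕ.m<n⇒m<1+n m<n) (es ∘ suc)
  in x , x≢0 , λ where
    zero    → sum-zero (λ i → cong (_* x i) (decidable-stable (es zero i ℤ.≟ 0ℤ) (λ p → e≡0 (i , p))))
    (suc k) → es·x≡0 k
... | yes (j , ej≢0) =
  let x , (i , xi≢0) , es·x≡0 = underdetermined m<n (eliminate ∘ es ∘ suc)
  in extend x
   , (punchIn j i , λ p → *-nonzero ej≢0 xi≢0 (trans (sym (insertAt-punchIn (λ k → e j * x k) j _ i)) p))
   , λ where
    zero    → trans (dot-extend e x) (sum-zero (λ k → cong (_* x k) (ℤ.+-inverseʳ (e j * e (punchIn j k)))))
    (suc k) → trans (dot-extend (es (suc k)) x) (es·x≡0 k)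
  where
  e = es zero
  open Pivot e j

δ : ∀ {n} → Fin n → Vector ℤ n
δ i j with i Fin.≟ j
... | yes _ = 1ℤ
... | no  _ = 0ℤ

δ-refl : ∀ {n} (i : Fin n) → δ i i ≡ 1ℤ
δ-refl i with i Fin.≟ i
... | yes _   = refl
... | no  i≢i = contradiction refl i≢i

δ-≢ : ∀ {n} {i j : Fin n} → i ≢ j → δ i j ≡ 0ℤ
δ-≢ {i = i} {j} i≢j with i Fin.≟ j
... | yes i≡j = contradiction i≡j i≢j
... | no  _   = refl

dot-δ : ∀ {n} i (x : Vector ℤ n) → dot (δ i) x ≡ x i
dot-δ i x = begin
  dot (δ i) x   ≡⟨ sum-single i (λ j j≢i → cong (_* x j) (δ-≢ (j≢i ∘ sym))) ⟩
  δ i i * x i   ≡⟨ cong (_* x i) (δ-refl i) ⟩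
  1ℤ * x i      ≡⟨ ℤ.*-identityˡ (x i) ⟩
  x i           ∎
  where open ≡-Reasoning

sum-linear : ∀ {n} c d (f g : Vector ℤ n) → sum (λ i → c * f i + d * g i) ≡ c * sum f + d * sum g
sum-linear c d f g = trans (∑-distrib-+ (λ i → c * f i) _)
                           (sym (cong₂ _+_ (*-distribˡ-sum c f) (*-distribˡ-sum d g)))

sum-difference : ∀ {n} (f g : Vector ℤ n) → sum (λ i → f i - g i) ≡ sum f - sum g
sum-difference f g = begin
  sum (λ i → f i - g i)                 ≡⟨ sum-cong-≗ (λ i → lemma (f i) (g i)) ⟩
  sum (λ i → 1ℤ * f i + - 1ℤ * g i)     ≡⟨ sum-linear 1ℤ (- 1ℤ) f g ⟩
  1ℤ * sum f + - 1ℤ * sum g             ≡⟨ lemma (sum f) (sum g) ⟨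
  sum f - sum g                         ∎
  where
  open ≡-Reasoning
  lemma : ∀ a b → a - b ≡ 1ℤ * a + - 1ℤ * b
  lemma = solve-∀

dot-difference : ∀ {n} i j (x : Vector ℤ n) → dot (λ k → δ i k - δ j k) x ≡ x i - x j
dot-difference i j x = begin
  sum (λ k → (δ i k - δ j k) * x k)         ≡⟨ sum-cong-≗ (λ k → expand (δ i k) (δ j k) (x k)) ⟩
  sum (λ k → δ i k * x k - δ j k * x k)     ≡⟨ sum-difference (λ k → δ i k * x k) _ ⟩
  dot (δ i) x - dot (δ j) x                 ≡⟨ cong₂ _-_ (dot-δ i x) (dot-δ j x) ⟩
  x i - x j                                 ∎
  where
  open ≡-Reasoning
  expand : ∀ a b c → (a - b) * c ≡ a * c - b * c
  expand = solve-∀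

a-b≡0⇒a≡b : ∀ {a b} → a - b ≡ 0ℤ → a ≡ b
a-b≡0⇒a≡b {a} {b} = ℤ.i-j≡0⇒i≡j a b

square-nonneg : ∀ i → 0ℤ ℤ.≤ i * i
square-nonneg (pos n)   = subst (0ℤ ℤ.≤_) (ℤ.pos-* n n) (+≤+ z≤n)
square-nonneg -[1+ n ] = +≤+ z≤n

square-zero : ∀ {i} → i * i ≡ 0ℤ → i ≡ 0ℤ
square-zero {i} = [ id , id ]′ ∘ ℤ.i*j≡0⇒i≡0∨j≡0 i

-- Closed walks and cycles.

-- Pigeonhole yields some repetition. While two values inside the window agree, they delimit a
-- window with a smaller gap, so recursion on the gap ends.
simple-repeat : ∀ {n} (h : ℕ → Fin n) → ∃₂ λ s g → 0 < g × h (g ℕ.+ s) ≡ h s ×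
                (∀ {p q} → p < q → q < g → h (p ℕ.+ s) ≢ h (q ℕ.+ s))
simple-repeat {n} h with Fin.pigeonhole (ℕ.n<1+n n) (h ∘ toℕ)
... | i , j , i<j , hi≡hj =
  <-rec Shrinks shrink (toℕ j ℕ.∸ toℕ i) (toℕ i) (ℕ.m<n⇒0<n∸m i<j)
        (trans (cong h (ℕ.m∸n+n≡m (ℕ.<⇒≤ i<j))) (sym hi≡hj))
  where
  Shrinks : ℕ → Set
  Shrinks g = ∀ s → 0 < g → h (g ℕ.+ s) ≡ h s → ∃₂ λ s g → 0 < g × h (g ℕ.+ s) ≡ h s ×
              (∀ {p q} → p < q → q < g → h (p ℕ.+ s) ≢ h (q ℕ.+ s))
  shrink : ∀ g → (∀ {g′} → g′ < g → Shrinks g′) → Shrinks g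
  shrink g rec s 0<g returns
    with Fin.any? (λ (p : Fin g) → Fin.any? (λ (q : Fin g) → p Fin.<? q ×-dec h (toℕ p ℕ.+ s) Fin.≟ h (toℕ q ℕ.+ s)))
  ... | yes (p , q , p<q , hp≡hq) =
    rec (ℕ.≤-<-trans (ℕ.m∸n≤m (toℕ q) (toℕ p)) (Fin.toℕ<n q)) (toℕ p ℕ.+ s) (ℕ.m<n⇒0<n∸m p<q)
        (trans (cong h (trans (sym (ℕ.+-assoc (toℕ q ℕ.∸ toℕ p) (toℕ p) s)) (cong (ℕ._+ s) (ℕ.m∸n+n≡m (ℕ.<⇒≤ p<q))))) (sym hp≡hq))
  ... | no  ∄ = s , g , 0<g , returns , λ {p} {q} p<q q<g hp≡hq →
    let p<g = ℕ.<-trans p<q q<g in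
    ∄ (fromℕ< p<g , fromℕ< q<g ,
       subst₂ _<_ (sym (Fin.toℕ-fromℕ< p<g)) (sym (Fin.toℕ-fromℕ< q<g)) p<q ,
       subst₂ (λ a b → h (a ℕ.+ s) ≡ h (b ℕ.+ s)) (sym (Fin.toℕ-fromℕ< p<g)) (sym (Fin.toℕ-fromℕ< q<g)) hp≡hq)

module _ (H : Graph) where
  open Graph H

  -- Stated for any graph, as it serves both the triangulation and its dual. The equation for the
  -- vertices lets membership in the cycle be read off the walk.
  closed-walk⇒cycle : ∀ (h : ℕ → Vertex) g → 3 ≤ g → h g ≡ h 0 →
                      (∀ {p q} → p < q → q < g → h p ≢ h q) → (∀ t → Adj (h t) (h (suc t))) →
                      ∃[ C ] Cycle.vertices C ≡ applyUpTo h g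
  closed-walk⇒cycle h (suc g) 3≤g returns distinct adj = record
    { start   = h 0
    ; rest    = applyUpTo (h ∘ suc) g
    ; isCycle = record
      { long     = subst (3 ≤_) (sym (length-applyUpTo h (suc g))) 3≤g
      ; distinct = Unique.applyUpTo⁺₁ h (suc g) distinct
      -- One vertex more than the period is listed, and `returns` identifies it with the start.
      ; closed   = subst (Linked Adj) (trans (sym (applyUpTo-∷ʳ h (suc g))) (cong (applyUpTo h (suc g) ∷ʳ_) returns))
                         (Linked.applyUpTo⁺₂ h (suc (suc g)) adj)
      }
    } , refl

-- Colours and their indicators.

red≢blue : red ≢ blue
red≢blue ()

isColour : Colour → Colour → ℤ
isColour blue blue = 1ℤ
isColour red  red  = 1ℤ
isColour _    _    = 0ℤ

isColour-refl : ∀ c → isColour c c ≡ 1ℤ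
isColour-refl blue = refl
isColour-refl red  = refl

isColour-≢0 : ∀ c d → isColour c d ≢ 0ℤ → d ≡ c
isColour-≢0 blue blue _ = refl
isColour-≢0 blue red  p = contradiction refl p
isColour-≢0 red  blue p = contradiction refl p
isColour-≢0 red  red  _ = refl

≢red⇒blue : ∀ {c} → c ≢ red → c ≡ blue
≢red⇒blue {blue} _  = refl
≢red⇒blue {red}  ≢r = contradiction refl ≢r

isRed : Colour → Bool
isRed red  = inside
isRed blue = outside

isRed⁻¹ : ∀ {c} → isRed c ≡ inside → c ≡ red
isRed⁻¹ {red} _ = refl

-- Darts, faces and connectivity of a triangulation.

module Triangulation (T : PlanarTriangulation) where
  open PlanarTriangulation T public
  open Simple simple public

  Colouring : Set
  Colouring = Vertex → Colour

  ρ : Dart → Dart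
  ρ = rot ⟨$⟩ʳ_

  next-rev : ∀ a → next (rev a) ≡ ρ a
  next-rev a = cong ρ (rev-involutive a)

  src-ρ : ∀ a → src (ρ a) ≡ src a
  src-ρ a = sym (Equivalence.from (src-orbits a (ρ a)) (1 , refl))

  left-next : ∀ a → left (next a) ≡ left a
  left-next a = sym (Equivalence.from (left-orbits a (next a)) (1 , refl))

  src-next : ∀ a → src (next a) ≡ tgt a
  src-next a = src-ρ (rev a)

  left-ρ : ∀ a → left (ρ a) ≡ left (rev a)
  left-ρ a = trans (cong left (sym (next-rev a))) (left-next (rev a))

  next³ : ∀ a → next (next (next a)) ≡ a
  next³ a = proj₂ (triangulated a)

  tgt-next² : ∀ a → tgt (next (next a)) ≡ src a
  tgt-next² a = trans (sym (src-next (next (next a)))) (cong src (next³ a))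

  tgt-rev : ∀ a → tgt (rev a) ≡ src a
  tgt-rev a = cong src (rev-involutive a)

  -- `next` has period three on darts, so `go` can reduce any number of iterations modulo three.
  same-face : ∀ {a b} → left a ≡ left b → b ≡ a ⊎ b ≡ next a ⊎ b ≡ next (next a)
  same-face {a} {b} eq with Equivalence.to (left-orbits a b) eq
  ... | k , p = go k a p
    where
    go : ∀ k x → iterate next x k ≡ b → b ≡ x ⊎ b ≡ next x ⊎ b ≡ next (next x)
    go zero    x refl = inj₁ refl
    go (suc k) x eq with go k (next x) eq
    ... | inj₁ p        = inj₂ (inj₁ p)
    ... | inj₂ (inj₁ p) = inj₂ (inj₂ p)
    ... | inj₂ (inj₂ p) = inj₁ (trans p (next³ x))

  face-distinct : ∀ a → src a ≢ src (next (next a)) × src (next a) ≢ src (next (next a))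
  face-distinct a with IsCycle.distinct (proj₁ (triangulated a))
  ... | (_ ∷ ≢₁ ∷ []) ∷ (≢₂ ∷ []) ∷ _ = ≢₁ , ≢₂

  -- If `rev a` were `next a` or `next (next a)`, two corners of the triangle would coincide.
  left≢left-rev : ∀ a → left a ≢ left (rev a)
  left≢left-rev a eq with same-face eq
  ... | inj₁ p        = rev-≢ a p
  ... | inj₂ (inj₁ p) = proj₁ (face-distinct a) (trans (sym (tgt-rev a)) (trans (cong tgt p) (sym (src-next (next a)))))
  ... | inj₂ (inj₂ p) = proj₂ (face-distinct a) (trans (src-next a) (cong src p))

  -- There is a second vertex, and the first step of a path to it leaves `u`.
  dart-at : ∀ u → ∃[ a ] src a ≡ u
  dart-at u with Fin.any? (λ w → ¬? (u Fin.≟ w))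
  ... | no  all≡    = contradiction 0≡1 λ ()
    where
    same : ∀ w → u ≡ w
    same w = decidable-stable (u Fin.≟ w) (λ u≢w → all≡ (w , u≢w))
    w₀ w₁ : Vertex
    w₀ = fromℕ< {0} (ℕ.≤-trans (s≤s z≤n) 4≤#V)
    w₁ = fromℕ< {1} (ℕ.≤-trans (s≤s (s≤s z≤n)) 4≤#V)
    0≡1 : 0 ≡ 1
    0≡1 = trans (sym (Fin.toℕ-fromℕ< _)) (trans (cong toℕ (trans (sym (same w₀)) (same w₁))) (Fin.toℕ-fromℕ< _))
  ... | yes (w , u≢w) with connected u w
  ...   | ε                 = contradiction refl u≢w
  ...   | (a , src≡ , _) ◅ _ = a , src≡

  some-dart : Dart
  some-dart = proj₁ (dart-at (fromℕ< {0} (ℕ.≤-trans (s≤s z≤n) 4≤#V)))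

  rev-injective : ∀ {a b} → rev a ≡ rev b → a ≡ b
  rev-injective {a} {b} eq = trans (sym (rev-involutive a)) (trans (cong rev eq) (rev-involutive b))

  sum-rev : ∀ (f : Dart → ℤ) → sum f ≡ sum (f ∘ rev)
  sum-rev f = sum-permute f (permutation rev rev rev-involutive rev-involutive)

  constant-on-vertices : ∀ {A : Set} (X : Vertex → A) → (∀ a → X (src a) ≡ X (tgt a)) → ∀ u w → X u ≡ X w
  constant-on-vertices X inv u w = go (connected u w)
    where
    go : ∀ {u w} → Star Adj u w → X u ≡ X w
    go ε                        = refl
    go ((a , refl , refl) ◅ ps) = trans (inv a) (go ps)

  -- Turning from `a` to `ρ a` moves from the face on the left of `a` to the one on its right, and
  -- iterates of `ρ` reach every dart at `u`.
  constant-around : ∀ {A : Set} (Φ : Face → A) {u} → (∀ a → src a ≡ u → Φ (left a) ≡ Φ (left (rev a))) →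
                    ∀ {a b} → src a ≡ u → src b ≡ u → Φ (left a) ≡ Φ (left b)
  constant-around Φ {u} inv {a} {b} src≡u src≡u′ with Equivalence.to (src-orbits a b) (trans src≡u (sym src≡u′))
  ... | k , p = go k a src≡u p
    where
    go : ∀ k a → src a ≡ u → iterate ρ a k ≡ b → Φ (left a) ≡ Φ (left b)
    go zero    a _   refl = refl
    go (suc k) a src≡u p    =
      trans (inv a src≡u) (trans (cong Φ (sym (left-ρ a))) (go k (ρ a) (trans (src-ρ a) src≡u) p))

  -- Connectedness of the dual, deduced from that of the graph: `Φ` is constant around each vertex,
  -- so it induces the function `at` on vertices, which does not change along a dart.
  constant-on-faces : ∀ {A : Set} (Φ : Face → A) → (∀ a → Φ (left a) ≡ Φ (left (rev a))) → ∀ f g → Φ f ≡ Φ g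
  constant-on-faces {A} Φ inv f g with left-surjective f | left-surjective g
  ... | a , refl | b , refl =
    trans (around refl (proj₂ (dart-at (src a))))
      (trans (constant-on-vertices at across (src a) (src b)) (around (proj₂ (dart-at (src b))) refl))
    where
    around : ∀ {u a b} → src a ≡ u → src b ≡ u → Φ (left a) ≡ Φ (left b)
    around = constant-around Φ (λ a _ → inv a)
    at : Vertex → A
    at u = Φ (left (proj₁ (dart-at u)))
    across : ∀ a → at (src a) ≡ at (tgt a)
    across a = trans (around (proj₂ (dart-at (src a))) refl)
                 (trans (inv a) (around refl (proj₂ (dart-at (tgt a)))))

  -- Flows and boundaries.

  -- Kirchhoff's law at the vertices, tested against all potentials X at once.
  record Flow (W : Dart → ℤ) : Set where
    field
      antisymmetric : ∀ a → W (rev a) ≡ - W a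
      balanced      : ∀ (X : Vertex → ℤ) → sum (λ a → X (src a) * W a) ≡ 0ℤ
  open Flow

  -- The cellular boundary of the 2-chain `Φ`: a dart runs forwards along the face on its left and
  -- backwards along the one on its right.
  ∂ : (Face → ℤ) → Dart → ℤ
  ∂ Φ a = Φ (left a) - Φ (left (rev a))

  ∂-antisymmetric : ∀ Φ a → ∂ Φ (rev a) ≡ - ∂ Φ a
  ∂-antisymmetric Φ a = trans (cong (λ b → Φ (left (rev a)) - Φ (left b)) (rev-involutive a)) (lemma (Φ (left (rev a))) (Φ (left a)))
    where
    lemma : ∀ a b → a - b ≡ - (b - a)
    lemma = solve-∀

  -- Balance is the fact that a boundary has no boundary. The face on the right of `a` is the one on
  -- the left of `ρ a`, so the sum is `sum f` minus its rearrangement by `rot`.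
  ∂-flow : ∀ Φ → Flow (∂ Φ)
  ∂-flow Φ .antisymmetric = ∂-antisymmetric Φ
  ∂-flow Φ .balanced X = begin
    sum (λ a → X (src a) * ∂ Φ a)          ≡⟨ sum-cong-≗ (λ a → trans (expand (X (src a)) _ _) (cong₂ (λ u g → f a - X u * Φ g) (sym (src-ρ a)) (sym (left-ρ a)))) ⟩
    sum (λ a → f a - f (ρ a))              ≡⟨ sum-difference f _ ⟩
    sum f - sum (f ∘ ρ)                    ≡⟨ cong (λ s → sum f - s) (sym (sum-permute f rot)) ⟩
    sum f - sum f                          ≡⟨ ℤ.+-inverseʳ (sum f) ⟩
    0ℤ                                     ∎
    where
    open ≡-Reasoning
    f : Dart → ℤ
    f a = X (src a) * Φ (left a)
    expand : ∀ a b c → a * (b - c) ≡ a * b - a * c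
    expand = solve-∀

  +-flow : ∀ n {Z W} → Flow Z → Flow W → Flow (λ a → n * Z a + W a)
  +-flow n {Z} {W} Z-flow W-flow .antisymmetric a =
    trans (cong₂ (λ p q → n * p + q) (antisymmetric Z-flow a) (antisymmetric W-flow a)) (lemma n (Z a) (W a))
    where
    lemma : ∀ n a b → n * - a + - b ≡ - (n * a + b)
    lemma = solve-∀
  +-flow n {Z} {W} Z-flow W-flow .balanced X = begin
    sum (λ a → X (src a) * (n * Z a + W a))
      ≡⟨ sum-cong-≗ (λ a → lemma n (X (src a)) (Z a) (W a)) ⟩
    sum (λ a → n * (X (src a) * Z a) + 1ℤ * (X (src a) * W a))
      ≡⟨ sum-linear n 1ℤ (λ a → X (src a) * Z a) _ ⟩
    n * sum (λ a → X (src a) * Z a) + 1ℤ * sum (λ a → X (src a) * W a)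
      ≡⟨ cong₂ (λ p q → n * p + 1ℤ * q) (balanced Z-flow X) (balanced W-flow X) ⟩
    n * 0ℤ + 1ℤ * 0ℤ
      ≡⟨ cong (_+ 0ℤ) (ℤ.*-zeroʳ n) ⟩
    0ℤ ∎
    where
    open ≡-Reasoning
    lemma : ∀ n x a b → x * (n * a + b) ≡ n * (x * a) + 1ℤ * (x * b)
    lemma = solve-∀

  -- By antisymmetry, reversing all darts turns the part with the targets into a second copy of the
  -- part with the sources; each is zero by balance.
  flow-⊥-coboundary : ∀ {W} → Flow W → ∀ X → sum (λ a → (X (src a) - X (tgt a)) * W a) ≡ 0ℤ
  flow-⊥-coboundary {W} W-flow X = begin
    sum (λ a → (X (src a) - X (tgt a)) * W a)
      ≡⟨ sum-cong-≗ (λ a → trans (expand (X (src a)) (X (tgt a)) (W a)) (cong (λ w → X (src a) * W a + X (tgt a) * w) (sym (antisymmetric W-flow a)))) ⟩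
    sum (λ a → X (src a) * W a + X (tgt a) * W (rev a))
      ≡⟨ ∑-distrib-+ (λ a → X (src a) * W a) _ ⟩
    sum (λ a → X (src a) * W a) + sum (λ a → X (tgt a) * W (rev a))
      ≡⟨ cong (sum (λ a → X (src a) * W a) +_) (sum-rev (λ a → X (src a) * W a)) ⟨
    sum (λ a → X (src a) * W a) + sum (λ a → X (src a) * W a)
      ≡⟨ cong₂ _+_ (balanced W-flow X) (balanced W-flow X) ⟩
    0ℤ ∎
    where
    open ≡-Reasoning
    expand : ∀ a b c → (a - b) * c ≡ a * c + b * - c
    expand = solve-∀

  -- Vanishing of the first homology of the sphere.

  representatives : List Dart
  representatives = filter (λ a → a Fin.<? rev a) (allFin _)

  ∈-representatives : ∀ {a} → a Fin.< rev a → a ∈ representatives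
  ∈-representatives = ∈-filter⁺ _ (∈-allFin _)

  -- The representatives and their reverses are disjoint, so twice their number is at most the
  -- number of darts. This bounds the number of equations in `exactness`.
  length-representatives : length representatives ≤ #E
  length-representatives = ℕ.*-cancelˡ-≤ 2 (subst₂ _≤_ length-all (length-tabulate id)
    (unique-⊆⇒length≤ (Unique.++⁺ reps! (Unique.map⁺ rev-injective reps!) disjoint) (λ _ → ∈-allFin _)))
    where
    reps! : Unique representatives
    reps! = Unique.filter⁺ _ (Unique.allFin⁺ _)
    rep⇒< : ∀ {a} → a ∈ representatives → a Fin.< rev a
    rep⇒< = proj₂ ∘ ∈-filter⁻ (λ a → a Fin.<? rev a) {xs = allFin _}
    disjoint : ∀ {a} → ¬ (a ∈ representatives × a ∈ map rev representatives)
    disjoint (p , q) with ∈-map⁻ rev q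
    ... | b , b∈ , refl = Fin.<-asym (rep⇒< b∈) (subst (rev b Fin.<_) (rev-involutive b) (rep⇒< p))
    length-all : length (representatives ++ᴸ map rev representatives) ≡ 2 ℕ.* length representatives
    length-all = trans (length-++ representatives) (cong (length representatives ℕ.+_) (trans (length-map rev representatives) (sym (ℕ.+-identityʳ _))))

  antisymmetric-zero : ∀ {U : Dart → ℤ} → (∀ a → U (rev a) ≡ - U a) → (∀ k → U (lookup representatives k) ≡ 0ℤ) → ∀ a → U a ≡ 0ℤ
  antisymmetric-zero {U} anti zero-up a = go (Fin.<-cmp a (rev a))
    where
    up : ∀ {a} → a Fin.< rev a → U a ≡ 0ℤ
    up a< = subst (λ b → U b ≡ 0ℤ) (sym (lookup-index (∈-representatives a<))) (zero-up (index (∈-representatives a<)))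
    go : Tri (a Fin.< rev a) (a ≡ rev a) (rev a Fin.< a) → U a ≡ 0ℤ
    go (tri< a< _ _) = up a<
    go (tri≈ _ a≡ _) = contradiction (sym a≡) (rev-≢ a)
    go (tri> _ _ >a) = ℤ.neg-injective (trans (sym (anti a)) (up (subst (rev a Fin.<_) (sym (rev-involutive a)) >a)))

  -- The first homology of the sphere vanishes.  Solving n Z + ∂ Φ + D = 0 with D the
  -- coboundary of X, on one dart per edge and with Φ and X normalised to vanish at one
  -- place, means #E + 2 equations in 1 + #F + #V = #E + 3 unknowns.  In a nonzero
  -- solution D is orthogonal to the flow n Z + ∂ Φ = - D, hence zero.
  exactness : ∀ {Z} → Flow Z → ∃₂ λ n Φ → n ≢ 0ℤ × (∀ a → n * Z a + ∂ Φ a ≡ 0ℤ)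
  exactness {Z} Z-flow = n , Φ , n≢0 , U≡0
    where
    coefficients : ℤ → Vector ℤ #F → Vector ℤ #V → Vector ℤ (suc (#F ℕ.+ #V))
    coefficients z φ ξ = z ∷ᵛ (φ ++ ξ)

    equations : Fin (2 ℕ.+ length representatives) → Vector ℤ (suc (#F ℕ.+ #V))
    equations zero          = coefficients 0ℤ (δ (left some-dart)) (λ _ → 0ℤ)
    equations (suc zero)    = coefficients 0ℤ (λ _ → 0ℤ) (δ (src some-dart))
    equations (suc (suc k)) = let a = lookup representatives k in
      coefficients (Z a) (λ f → δ (left a) f - δ (left (rev a)) f) (λ u → δ (src a) u - δ (tgt a) u)

    fewer : 2 ℕ.+ length representatives < suc (#F ℕ.+ #V)
    -- Euler's formula enters here; it leaves exactly one unknown to spare.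
    fewer = s≤s (ℕ.≤-trans (ℕ.+-monoʳ-≤ 2 length-representatives) (ℕ.≤-reflexive (trans (ℕ.+-comm 2 #E) (trans (sym genusZero) (ℕ.+-comm #V #F)))))

    solution = underdetermined fewer equations
    x = proj₁ solution

    n : ℤ
    n = x zero
    Φ : Face → ℤ
    Φ f = x (suc (f ↑ˡ #V))
    X : Vertex → ℤ
    X u = x (suc (#F ↑ʳ u))

    dot-coefficients : ∀ z φ ξ → dot (coefficients z φ ξ) x ≡ z * n + (dot φ Φ + dot ξ X)
    dot-coefficients z φ ξ = cong (z * n +_) (dot-++ φ ξ (x ∘ suc))

    Φ₀≡0 : Φ (left some-dart) ≡ 0ℤ
    Φ₀≡0 = begin
      Φ (left some-dart)                                           ≡⟨ dot-δ (left some-dart) Φ ⟨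
      dot (δ (left some-dart)) Φ                                   ≡⟨ lemma n _ ⟩
      0ℤ * n + (dot (δ (left some-dart)) Φ + 0ℤ)                   ≡⟨ cong (λ s → 0ℤ * n + (dot (δ (left some-dart)) Φ + s)) (sum-zero {t = λ u → 0ℤ * X u} (λ _ → refl)) ⟨
      0ℤ * n + (dot (δ (left some-dart)) Φ + dot (λ _ → 0ℤ) X)     ≡⟨ dot-coefficients 0ℤ (δ (left some-dart)) (λ _ → 0ℤ) ⟨
      dot (equations zero) x                                       ≡⟨ proj₂ (proj₂ solution) zero ⟩
      0ℤ                                                           ∎
      where
      open ≡-Reasoning
      lemma : ∀ n a → a ≡ 0ℤ * n + (a + 0ℤ)
      lemma = solve-∀

    X₀≡0 : X (src some-dart) ≡ 0ℤ
    X₀≡0 = begin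
      X (src some-dart)                                            ≡⟨ dot-δ (src some-dart) X ⟨
      dot (δ (src some-dart)) X                                    ≡⟨ lemma n _ ⟩
      0ℤ * n + (0ℤ + dot (δ (src some-dart)) X)                    ≡⟨ cong (λ s → 0ℤ * n + (s + dot (δ (src some-dart)) X)) (sum-zero {t = λ f → 0ℤ * Φ f} (λ _ → refl)) ⟨
      0ℤ * n + (dot (λ _ → 0ℤ) Φ + dot (δ (src some-dart)) X)      ≡⟨ dot-coefficients 0ℤ (λ _ → 0ℤ) (δ (src some-dart)) ⟨
      dot (equations (suc zero)) x                                 ≡⟨ proj₂ (proj₂ solution) (suc zero) ⟩
      0ℤ                                                           ∎
      where
      open ≡-Reasoning
      lemma : ∀ n a → a ≡ 0ℤ * n + (0ℤ + a)
      lemma = solve-∀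

    U D : Dart → ℤ
    U a = n * Z a + ∂ Φ a
    D a = X (src a) - X (tgt a)

    U-flow : Flow U
    U-flow = +-flow n Z-flow (∂-flow Φ)

    U+D≡0 : ∀ a → U a + D a ≡ 0ℤ
    U+D≡0 = antisymmetric-zero {λ a → U a + D a}
      (λ a → trans (cong₂ _+_ (antisymmetric U-flow a) (cong (λ b → X (tgt a) - X (src b)) (rev-involutive a)))
                   (lemma (U a) (X (tgt a)) (X (src a))))
      (λ k → let a = lookup representatives k in
        trans (sym (trans (dot-coefficients (Z a) _ _)
                          (trans (cong₂ (λ s t → Z a * n + (s + t)) (dot-difference (left a) (left (rev a)) Φ) (dot-difference (src a) (tgt a) X))
                                 (reorder (Z a) n (∂ Φ a) (D a)))))
              (proj₂ (proj₂ solution) (suc (suc k))))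
      where
      lemma : ∀ u x y → - u + (x - y) ≡ - (u + (y - x))
      lemma = solve-∀
      reorder : ∀ z n p d → z * n + (p + d) ≡ n * z + p + d
      reorder = solve-∀

    D≡0 : ∀ a → D a ≡ 0ℤ
    D≡0 a = square-zero (sum-nonneg-zero (λ a → square-nonneg (D a)) ΣD²≡0 a)
      where
      open ≡-Reasoning
      lemma : ∀ d u → d * u + d * d ≡ d * (u + d)
      lemma = solve-∀
      ΣD²≡0 : sum (λ a → D a * D a) ≡ 0ℤ
      ΣD²≡0 = begin
        sum (λ a → D a * D a)                               ≡⟨ ℤ.+-identityˡ _ ⟨
        0ℤ + sum (λ a → D a * D a)                          ≡⟨ cong (_+ sum (λ a → D a * D a)) (flow-⊥-coboundary U-flow X) ⟨
        sum (λ a → D a * U a) + sum (λ a → D a * D a)       ≡⟨ ∑-distrib-+ (λ a → D a * U a) _ ⟨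
        sum (λ a → D a * U a + D a * D a)                   ≡⟨ sum-zero (λ a → trans (lemma (D a) (U a)) (trans (cong (D a *_) (U+D≡0 a)) (ℤ.*-zeroʳ (D a)))) ⟩
        0ℤ                                                  ∎

    X≡0 : ∀ u → X u ≡ 0ℤ
    X≡0 u = trans (constant-on-vertices X (λ a → a-b≡0⇒a≡b (D≡0 a)) u (src some-dart)) X₀≡0

    U≡0 : ∀ a → U a ≡ 0ℤ
    U≡0 a = trans (sym (ℤ.+-identityʳ (U a))) (trans (cong (U a +_) (sym (D≡0 a))) (U+D≡0 a))

    n≢0 : n ≢ 0ℤ
    -- With `n` zero, `∂ Φ` would vanish, so `Φ` would be constant, and zero by its normalisation.
    -- As `X` is zero too, the whole solution would be trivial.
    n≢0 n≡0 = proj₂ (proj₁ (proj₂ solution)) (x≡0 (proj₁ (proj₁ (proj₂ solution))))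
      where
      ∂Φ≡0 : ∀ a → ∂ Φ a ≡ 0ℤ
      ∂Φ≡0 a = trans (sym (ℤ.+-identityˡ _)) (trans (cong (λ m → m * Z a + ∂ Φ a) (sym n≡0)) (U≡0 a))
      Φ≡0 : ∀ f → Φ f ≡ 0ℤ
      Φ≡0 f = trans (constant-on-faces Φ (λ a → a-b≡0⇒a≡b (∂Φ≡0 a)) f (left some-dart)) Φ₀≡0
      x≡0 : ∀ i → x i ≡ 0ℤ
      x≡0 zero    = n≡0
      x≡0 (suc k) with Fin.splitAt #F k in eq
      ... | inj₁ f = subst (λ k → x (suc k) ≡ 0ℤ) (Fin.splitAt⁻¹-↑ˡ eq) (Φ≡0 f)
      ... | inj₂ u = subst (λ k → x (suc k) ≡ 0ℤ) (Fin.splitAt⁻¹-↑ʳ eq) (X≡0 u)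

  -- Supports of flows and the cycles in them.

  -- Only sources are constrained; for a flow, antisymmetry carries the condition over to the
  -- targets, as in `support-tgt`.
  SupportedOn : Colouring → Colour → (Dart → ℤ) → Set
  SupportedOn col c W = ∀ a → W a ≢ 0ℤ → col (src a) ≡ c

  support-rev : ∀ {W} → Flow W → ∀ {a} → W a ≢ 0ℤ → W (rev a) ≢ 0ℤ
  support-rev W-flow {a} Wa≢0 p = Wa≢0 (ℤ.neg-injective (trans (sym (antisymmetric W-flow a)) p))

  support-tgt : ∀ {col c W} → Flow W → SupportedOn col c W → ∀ a → W a ≢ 0ℤ → col (tgt a) ≡ c
  support-tgt W-flow support a Wa≢0 = support (rev a) (support-rev W-flow Wa≢0)

  -- Balance tested against the indicator of `src a`: a single nonzero dart there would leave `W a`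
  -- as the whole sum.
  other-support : ∀ {W} → Flow W → ∀ {a} → W a ≢ 0ℤ → ∃[ b ] src b ≡ src a × b ≢ a × W b ≢ 0ℤ
  other-support {W} W-flow {a} Wa≢0
    with Fin.any? (λ b → src b Fin.≟ src a ×-dec ¬? (b Fin.≟ a) ×-dec ¬? (W b ℤ.≟ 0ℤ))
  ... | yes b = b
  ... | no  ∄ = contradiction Wa≡0 Wa≢0
    where
    open ≡-Reasoning
    others : ∀ b → b ≢ a → δ (src a) (src b) * W b ≡ 0ℤ
    others b b≢a with src a Fin.≟ src b
    ... | no  _ = refl
    ... | yes p = trans (ℤ.*-identityˡ (W b)) (decidable-stable (W b ℤ.≟ 0ℤ) (λ Wb≢0 → ∄ (b , sym p , b≢a , Wb≢0)))
    Wa≡0 : W a ≡ 0ℤ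
    Wa≡0 = begin
      W a                                      ≡⟨ ℤ.*-identityˡ (W a) ⟨
      1ℤ * W a                                 ≡⟨ cong (_* W a) (δ-refl (src a)) ⟨
      δ (src a) (src a) * W a                  ≡⟨ sum-single {t = λ b → δ (src a) (src b) * W b} a others ⟨
      sum (λ b → δ (src a) (src b) * W b)      ≡⟨ balanced W-flow (δ (src a)) ⟩
      0ℤ                                       ∎

  -- By `other-support`, a walk inside the support can go on forever without turning back, and it
  -- must repeat a vertex. A closed part of length 1 would be a loop; one of length 2 would traverse
  -- an edge and, the graph being simple, return along it.
  support-cycle : ∀ {W} → Flow W → ∀ {a} → W a ≢ 0ℤ →
                  Σ Cycle λ C → ∀ {v} → v ∈ Cycle.vertices C → ∃[ b ] src b ≡ v × W b ≢ 0ℤ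
  support-cycle {W} W-flow {a} Wa≢0 =
    let s , g , 0<g , returns , distinct = simple-repeat h
        C , C≡ = closed-walk⇒cycle graph (λ t → h (t ℕ.+ s)) g (long 0<g returns) returns distinct
                   (λ t → walk (t ℕ.+ s) , refl , sym (src-walk (t ℕ.+ s)))
    in C , λ v∈C → let t , _ , v≡ = ∈-applyUpTo⁻ (λ t → h (t ℕ.+ s)) (subst (_ ∈_) C≡ v∈C)
                   in walk (t ℕ.+ s) , sym v≡ , proj₂ (steps (t ℕ.+ s))
    where
    onward : ∀ (b : ∃[ b ] W b ≢ 0ℤ) → ∃[ c ] src c ≡ tgt (proj₁ b) × c ≢ rev (proj₁ b) × W c ≢ 0ℤ
    onward (b , Wb≢0) = other-support W-flow (support-rev W-flow Wb≢0)
    steps : ℕ → ∃[ b ] W b ≢ 0ℤ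
    steps zero    = a , Wa≢0
    steps (suc k) = let c , _ , _ , Wc≢0 = onward (steps k) in c , Wc≢0
    walk : ℕ → Dart
    walk = proj₁ ∘ steps
    h : ℕ → Vertex
    h = src ∘ walk
    src-walk : ∀ k → src (walk (suc k)) ≡ tgt (walk k)
    src-walk k = proj₁ (proj₂ (onward (steps k)))
    long : ∀ {g s} → 0 < g → h (g ℕ.+ s) ≡ h s → 3 ≤ g
    long {1} {s} _ returns = contradiction (trans (sym returns) (src-walk s)) (no-loops (walk s))
    long {2} {s} _ returns = contradiction
      (no-parallel (walk (1 ℕ.+ s)) (rev (walk s)) (src-walk s) (trans (sym (src-walk (1 ℕ.+ s))) (trans returns (sym (tgt-rev (walk s))))))
      (proj₁ (proj₂ (proj₂ (onward (steps s)))))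
    long {suc (suc (suc g))} _ _ = s≤s (s≤s (s≤s z≤n))

  -- Corners of faces, and the conditions on colourings.

  corners : Dart → List Vertex
  corners a = src a ∷ src (next a) ∷ src (next (next a)) ∷ []

  src∈corners : ∀ {a b} → left a ≡ left b → src b ∈ corners a
  src∈corners eq with same-face eq
  ... | inj₁ refl        = here refl
  ... | inj₂ (inj₁ refl) = there (here refl)
  ... | inj₂ (inj₂ refl) = there (there (here refl))

  tgt∈corners : ∀ {a b} → left a ≡ left b → tgt b ∈ corners a
  tgt∈corners {a} {b} eq = subst (_∈ corners a) (src-next b) (src∈corners (trans eq (sym (left-next b))))

  -- The two sides of a dart are distinct, so with only two faces every dart would border `f`. Then
  -- every vertex would be one of the three corners of `f`.
  more-than-two-faces : ∀ f g → ¬ (∀ k → k ≡ f ⊎ k ≡ g)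
  more-than-two-faces f g only with left-surjective f
  ... | a , refl = contradiction
    (subst (_≤ 3) (length-tabulate id) (unique-⊆⇒length≤ (Unique.allFin⁺ #V) (λ {u} _ → all-corners u)))
    (ℕ.<⇒≱ 4≤#V)
    where
    borders : ∀ d → left a ≡ left d ⊎ left a ≡ left (rev d)
    borders d with only (left d) | only (left (rev d))
    ... | inj₁ p | _      = inj₁ (sym p)
    ... | _      | inj₁ q = inj₂ (sym q)
    ... | inj₂ p | inj₂ q = contradiction (trans p (sym q)) (left≢left-rev d)
    all-corners : ∀ u → u ∈ corners a
    all-corners u with dart-at u
    ... | d , refl with borders d
    ...   | inj₁ p = src∈corners p
    ...   | inj₂ p = subst (_∈ corners a) (tgt-rev d) (tgt∈corners p)

  NoRedFace : Colouring → Set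
  NoRedFace col = ∀ a → ¬ All (λ v → col v ≡ red) (corners a)

  -- Acyclicity of the blue subgraph in homological form: unlike a statement about
  -- lists of vertices, it is easily seen to survive the recolouring.
  BlueForest : Colouring → Set
  BlueForest col = ∀ {Z} → Flow Z → SupportedOn col blue Z → ∀ a → Z a ≡ 0ℤ

  RedCyclesHaveDegree≤4 : Colouring → Set
  RedCyclesHaveDegree≤4 col = ∀ C → All (λ v → col v ≡ red) (Cycle.vertices C) → Any (λ v → degree v ≤ 4) (Cycle.vertices C)

  -- Balance holds for any cut-off by a function of the source, as this function is absorbed into
  -- the test potential. Antisymmetry is what needs the support to be monochromatic.
  restrict-flow : ∀ (col : Colouring) c {W} → Flow W → (∀ a → W a ≢ 0ℤ → col (src a) ≡ col (tgt a)) →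
                  Flow (λ a → isColour c (col (src a)) * W a)
  restrict-flow col c {W} W-flow mono .antisymmetric a with W a ℤ.≟ 0ℤ
  ... | yes Wa≡0 = begin
    isColour c (col (tgt a)) * W (rev a)     ≡⟨ cong (isColour c (col (tgt a)) *_) (trans (antisymmetric W-flow a) (cong -_ Wa≡0)) ⟩
    isColour c (col (tgt a)) * 0ℤ            ≡⟨ ℤ.*-zeroʳ (isColour c (col (tgt a))) ⟩
    - 0ℤ                                     ≡⟨ cong -_ (ℤ.*-zeroʳ (isColour c (col (src a)))) ⟨
    - (isColour c (col (src a)) * 0ℤ)        ≡⟨ cong (λ w → - (isColour c (col (src a)) * w)) Wa≡0 ⟨
    - (isColour c (col (src a)) * W a)       ∎
    where open ≡-Reasoning
  ... | no  Wa≢0 = trans (cong₂ (λ d w → isColour c d * w) (sym (mono a Wa≢0)) (antisymmetric W-flow a))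
                         (sym (ℤ.neg-distribʳ-* (isColour c (col (src a))) (W a)))
  restrict-flow col c {W} W-flow mono .balanced X =
    trans (sum-cong-≗ (λ a → sym (ℤ.*-assoc (X (src a)) _ (W a)))) (balanced W-flow (λ u → X u * isColour c (col u)))

  -- The boundary of such a face would be a nonzero flow on blue vertices.
  no-blue-face : ∀ {col} → BlueForest col → ∀ a → ¬ All (λ v → col v ≡ blue) (corners a)
  no-blue-face {col} forest a all-blue = contradiction (trans (sym ∂Ψa≡1) (forest (∂-flow Ψ) support a)) λ ()
    where
    Ψ : Face → ℤ
    Ψ = δ (left a)
    ∂Ψa≡1 : ∂ Ψ a ≡ 1ℤ
    ∂Ψa≡1 = cong₂ _-_ (δ-refl (left a)) (δ-≢ (left≢left-rev a))
    support : ∀ b → ∂ Ψ b ≢ 0ℤ → col (src b) ≡ blue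
    support b ∂Ψb≢0 with left a Fin.≟ left b
    ... | yes p = All.lookup all-blue (src∈corners p)
    ... | no  _ with left a Fin.≟ left (rev b)
    ...   | yes q = All.lookup all-blue (subst (_∈ corners a) (tgt-rev b) (tgt∈corners q))
    ...   | no  _ = contradiction refl ∂Ψb≢0

  no-blue-cycle⇒BlueForest : ∀ {col} → ¬ (∃[ C ] All (λ v → col v ≡ blue) (Cycle.vertices C)) → BlueForest col
  no-blue-cycle⇒BlueForest {col} ∄ {Z} Z-flow support a = decidable-stable (Z a ℤ.≟ 0ℤ) λ Za≢0 →
    let C , C⊆ = support-cycle Z-flow Za≢0
    in ∄ (C , All.tabulate (λ v∈C → let b , src≡v , Zb≢0 = C⊆ v∈C in subst (λ v → col v ≡ blue) src≡v (support b Zb≢0)))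

  -- The dual curves between red and blue.

  module Crossings (col : Colouring) (no-red : NoRedFace col) (forest : BlueForest col) where

    Crossing : Dart → Set
    Crossing a = col (src a) ≡ red × col (tgt a) ≡ blue

    -- Both colours occur on the face, so somewhere on its boundary walk red is followed by blue.
    crossing-in : ∀ f → ∃[ a ] left a ≡ f × Crossing a
    crossing-in f with left-surjective f
    ... | a , refl
      with col (src a) in e₀ | col (src (next a)) in e₁ | col (src (next (next a))) in e₂
    ... | red  | blue | _    = a , refl , e₀ , trans (cong col (sym (src-next a))) e₁
    ... | _    | red  | blue = next a , left-next a , e₁ , trans (cong col (sym (src-next (next a)))) e₂
    ... | blue | _    | red  = next (next a) , trans (left-next (next a)) (left-next a) , e₂ , trans (cong col (tgt-next² a)) e₀
    ... | red  | red  | red  = contradiction (e₀ ∷ e₁ ∷ e₂ ∷ []) (no-red a)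
    ... | blue | blue | blue = contradiction (e₀ ∷ e₁ ∷ e₂ ∷ []) (no-blue-face {col} forest a)

    -- Consecutive darts of a triangle share a vertex, so equal colour patterns on two of them would
    -- give `a` ends of the same colour. The form covers red to blue and also blue to red, which
    -- `σ-injective` needs.
    bichromatic-unique : ∀ {a b} → left a ≡ left b → col (src a) ≡ col (src b) → col (tgt a) ≡ col (tgt b) →
                         col (src a) ≢ col (tgt a) → b ≡ a
    bichromatic-unique {a} {b} same-left same-src same-tgt bichromatic with same-face same-left
    ... | inj₁ b≡a         = b≡a
    ... | inj₂ (inj₁ refl) = contradiction (trans same-src (cong col (src-next a))) bichromatic
    ... | inj₂ (inj₂ refl) = contradiction (sym (trans same-tgt (cong col (tgt-next² a)))) bichromatic

    crossing-unique : ∀ {a b} → left a ≡ left b → Crossing a → Crossing b → a ≡ b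
    crossing-unique eq (a₀ , a₁) (b₀ , b₁) =
      sym (bichromatic-unique eq (trans a₀ (sym b₀)) (trans a₁ (sym b₁)) (λ p → red≢blue (trans (sym a₀) (trans p a₁))))

    out : Face → Dart
    out f = proj₁ (crossing-in f)

    left-out : ∀ f → left (out f) ≡ f
    left-out f = proj₁ (proj₂ (crossing-in f))

    -- Follows the dual curve that keeps red on one side and blue on the other.
    σ : Face → Face
    σ f = left (rev (out f))

    σ-left : ∀ {a} → Crossing a → σ (left a) ≡ left (rev a)
    σ-left {a} a-crossing =
      cong (left ∘ rev) (crossing-unique (left-out (left a)) (proj₂ (proj₂ (crossing-in (left a)))) a-crossing)

    -- The reverses of the two outgoing darts both run from blue to red along the common image face,
    -- so they coincide.
    σ-injective : ∀ {f g} → σ f ≡ σ g → f ≡ g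
    σ-injective {f} {g} eq with crossing-in f | crossing-in g
    ... | a , refl , a₀ , a₁ | b , refl , b₀ , b₁ =
      cong left (sym (rev-injective (bichromatic-unique eq (trans a₁ (sym b₁))
        (trans (cong col (tgt-rev a)) (trans (trans a₀ (sym b₀)) (cong col (sym (tgt-rev b)))))
        (λ p → red≢blue (trans (sym a₀) (trans (cong col (sym (tgt-rev a))) (trans (sym p) a₁)))))))

    orbit : ℕ → Face
    orbit zero    = left some-dart
    orbit (suc k) = σ (orbit k)

    module Loop (s g : ℕ) (returns : orbit (suc g ℕ.+ s) ≡ orbit s)
                (distinct : ∀ {p q} → p < q → q < suc g → orbit (p ℕ.+ s) ≢ orbit (q ℕ.+ s)) where

      OnLoop : Face → Set
      OnLoop f = ∃[ t ] t < suc g × f ≡ orbit (t ℕ.+ s)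

      onLoop? : ∀ f → Dec (OnLoop f)
      onLoop? f with Fin.any? (λ (t : Fin (suc g)) → f Fin.≟ orbit (toℕ t ℕ.+ s))
      ... | yes (t , p) = yes (toℕ t , Fin.toℕ<n t , p)
      ... | no  ∄       = no λ (t , t<g , p) → ∄ (fromℕ< t<g , trans p (cong (λ t → orbit (t ℕ.+ s)) (sym (Fin.toℕ-fromℕ< t<g))))

      onLoop-σ : ∀ {f} → OnLoop f → OnLoop (σ f)
      onLoop-σ (t , t<g , refl) with ℕ.m≤n⇒m<n∨m≡n t<g
      ... | inj₁ t+1<g = suc t , t+1<g , refl
      ... | inj₂ refl  = 0 , z<s , returns

      onLoop-σ⁻¹ : ∀ {f} → OnLoop (σ f) → OnLoop f
      onLoop-σ⁻¹ (suc t , t+1<g , p) = t , ℕ.<-trans (ℕ.n<1+n t) t+1<g , σ-injective p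
      -- The face at time 0 is also the one at time `suc g`, hence the predecessor at time `g`.
      onLoop-σ⁻¹ (zero  , _     , p) = g , ℕ.n<1+n g , σ-injective (trans p (sym returns))

      Ψ : Face → ℤ
      Ψ f with onLoop? f
      ... | yes _ = 1ℤ
      ... | no  _ = 0ℤ

      Ψ-on : ∀ {f} → OnLoop f → Ψ f ≡ 1ℤ
      Ψ-on {f} on with onLoop? f
      ... | yes _  = refl
      ... | no off = contradiction on off

      Ψ-on⁻¹ : ∀ {f} → Ψ f ≡ 1ℤ → OnLoop f
      Ψ-on⁻¹ {f} p with onLoop? f
      ... | yes on = on

      Ψ-σ : ∀ f → Ψ (σ f) ≡ Ψ f
      Ψ-σ f with onLoop? f | onLoop? (σ f)
      ... | yes _  | yes _   = refl
      ... | no _   | no _    = refl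
      ... | yes on | no off  = contradiction (onLoop-σ on) off
      ... | no off | yes on  = contradiction (onLoop-σ⁻¹ on) off

      -- The faces on the two sides of a crossing are consecutive under `σ`, so the loop contains
      -- both or neither.
      ∂Ψ-crossing : ∀ {a} → Crossing a → ∂ Ψ a ≡ 0ℤ
      ∂Ψ-crossing {a} a-crossing =
        trans (cong (λ w → Ψ (left a) - w) (trans (cong Ψ (sym (σ-left a-crossing))) (Ψ-σ (left a)))) (ℤ.+-inverseʳ (Ψ (left a)))

      ∂Ψ-monochromatic : ∀ a → ∂ Ψ a ≢ 0ℤ → col (src a) ≡ col (tgt a)
      ∂Ψ-monochromatic a ∂Ψa≢0 with col (src a) in e₀ | col (tgt a) in e₁
      ... | red  | red  = refl
      ... | blue | blue = refl
      ... | red  | blue = contradiction (∂Ψ-crossing (e₀ , e₁)) ∂Ψa≢0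
      ... | blue | red  = contradiction (∂Ψ-crossing (e₁ , trans (cong col (tgt-rev a)) e₀)) (support-rev (∂-flow Ψ) ∂Ψa≢0)

      part : Colour → Dart → ℤ
      part c a = isColour c (col (src a)) * ∂ Ψ a

      part-flow : ∀ c → Flow (part c)
      part-flow c = restrict-flow col c (∂-flow Ψ) ∂Ψ-monochromatic

      part-support : ∀ c → SupportedOn col c (part c)
      part-support c a p = isColour-≢0 c (col (src a)) (λ q → p (cong (_* ∂ Ψ a) q))

      part-on : ∀ {c a} → col (src a) ≡ c → part c a ≡ ∂ Ψ a
      part-on {c} {a} refl = trans (cong (_* ∂ Ψ a) (isColour-refl (col (src a)))) (ℤ.*-identityˡ _)

      -- A dart with `∂ Ψ` nonzero cannot start at a blue vertex, because the blue part is a flow on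
      -- a forest; so the red part is nonzero there. If `∂ Ψ` vanishes everywhere, `Ψ` is constantly
      -- 1 and the loop visits all faces.
      hamiltonian-or-red-flow : Graph.Hamiltonian dual ⊎ (∃₂ λ W a → Flow W × SupportedOn col red W × W a ≢ 0ℤ)
      hamiltonian-or-red-flow with Fin.any? (λ a → ¬? (∂ Ψ a ℤ.≟ 0ℤ))
      ... | yes (a , ∂Ψa≢0) with col (src a) in e
      ...   | red  = inj₂ (part red , a , part-flow red , part-support red , λ p → ∂Ψa≢0 (trans (sym (part-on e)) p))
      ...   | blue = contradiction (trans (sym (part-on e)) (forest (part-flow blue) (part-support blue) a)) ∂Ψa≢0
      hamiltonian-or-red-flow | no ∄ = inj₁ (C , λ f → let t , t<g , f≡ = all-on f in
          subst₂ _∈_ (sym f≡) (sym C≡) (∈-applyUpTo⁺ (λ t → orbit (t ℕ.+ s)) t<g))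
        where
        all-on : ∀ f → OnLoop f
        all-on f = Ψ-on⁻¹ (trans
          (constant-on-faces Ψ (λ a → a-b≡0⇒a≡b (decidable-stable (∂ Ψ a ℤ.≟ 0ℤ) (λ p → ∄ (a , p)))) f (orbit s))
          (Ψ-on (0 , z<s , refl)))
        covered : ∀ {g} → g ≤ 2 → ∀ {f} → (∃[ t ] t < g × f ≡ orbit (t ℕ.+ s)) → f ≡ orbit s ⊎ f ≡ orbit (1 ℕ.+ s)
        covered g≤2 (0           , _   , p) = inj₁ p
        covered g≤2 (1           , _   , p) = inj₂ p
        covered g≤2 (suc (suc t) , t<g , p) = contradiction (ℕ.≤-trans t<g g≤2) λ where (s≤s (s≤s ()))
        3≤g : 3 ≤ suc g
        -- A shorter loop through all faces would leave at most two of them.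
        3≤g = ℕ.≰⇒> λ g≤2 → more-than-two-faces (orbit s) (orbit (1 ℕ.+ s)) (λ f → covered g≤2 (all-on f))
        cycle : ∃[ C ] Graph.Cycle.vertices {dual} C ≡ applyUpTo (λ t → orbit (t ℕ.+ s)) (suc g)
        cycle = closed-walk⇒cycle dual (λ t → orbit (t ℕ.+ s)) (suc g) 3≤g returns distinct
                  (λ t → out (orbit (t ℕ.+ s)) , left-out _ , refl)
        C = proj₁ cycle
        C≡ = proj₂ cycle

    hamiltonian-or-red-flow : Graph.Hamiltonian dual ⊎ (∃₂ λ W a → Flow W × SupportedOn col red W × W a ≢ 0ℤ)
    hamiltonian-or-red-flow with simple-repeat orbit
    ... | s , suc g , _ , returns , distinct = Loop.hamiltonian-or-red-flow s g returns distinct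

  -- Red vertices of degree at most four.

  ρ-injective : ∀ {a b} → ρ a ≡ ρ b → a ≡ b
  ρ-injective eq = trans (sym (inverseˡ rot)) (trans (cong (rot ⟨$⟩ˡ_) eq) (inverseˡ rot))

  -- The darts are only assumed distinct; that they lie opposite each other is derived in `ρ²x≡y`.
  record OppositeReds (col : Colouring) (v : Vertex) (x y : Dart) : Set where
    field
      src-x   : src x ≡ v
      src-y   : src y ≡ v
      x≢y     : x ≢ y
      red-v   : col v ≡ red
      red-x   : col (tgt x) ≡ red
      red-y   : col (tgt y) ≡ red
      degree≤ : degree v ≤ 4

  module Degree4 {col : Colouring} (no-red : NoRedFace col) {v x y} (opposite : OppositeReds col v x y) where
    open OppositeReds opposite

    -- The corners of the face between `d` and `ρ d` are `tgt d`, `v` and `tgt (ρ d)`, and they are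
    -- not all red.
    blue-after : ∀ {d} → src d ≡ v → col (tgt d) ≡ red → col (tgt (ρ d)) ≡ blue
    blue-after {d} refl red-d = ≢red⇒blue λ red-ρd → no-red (rev d)
      (red-d ∷ trans (cong col (trans (src-next (rev d)) (tgt-rev d))) red-v
             ∷ trans (cong col (trans (src-next (next (rev d))) (cong tgt (next-rev d)))) red-ρd ∷ [])

    blue-x : col (tgt (ρ x)) ≡ blue
    blue-x = blue-after src-x red-x

    blue-y : col (tgt (ρ y)) ≡ blue
    blue-y = blue-after src-y red-y

    red≢ : ∀ {a b} → col (tgt a) ≡ red → col (tgt b) ≡ blue → a ≢ b
    red≢ red-a blue-b refl = red≢blue (trans (sym red-a) blue-b)

    spokes : List Dart
    spokes = x ∷ ρ x ∷ y ∷ ρ y ∷ []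

    spokes! : Unique spokes
    spokes! = (red≢ red-x blue-x ∷ x≢y ∷ red≢ red-x blue-y ∷ [])
            ∷ (≢-sym (red≢ red-y blue-x) ∷ x≢y ∘ ρ-injective ∷ [])
            ∷ (red≢ red-y blue-y ∷ [])
            ∷ [] ∷ []

    -- The four spokes are distinct, so a further dart at `v` would push the degree to five.
    all-spokes : ∀ {d} → src d ≡ v → d ∈ spokes
    all-spokes {d} src-d = decidable-stable (Any.any? (d Fin.≟_) spokes) λ d∉ →
      contradiction (ℕ.≤-trans (unique-⊆⇒length≤ (¬Any⇒All¬ spokes d∉ ∷ spokes!) at-v) degree≤) (ℕ.<-irrefl refl)
      where
      at-v : ∀ {e} → e ∈ d ∷ spokes → e ∈ filter (λ a → src a Fin.≟ v) (allFin (2 ℕ.* #E))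
      at-v e∈ = ∈-filter⁺ (λ a → src a Fin.≟ v) (∈-allFin _) (All.lookup
        (src-d ∷ src-x ∷ trans (src-ρ x) src-x ∷ src-y ∷ trans (src-ρ y) src-y ∷ []) e∈)

    -- The values `ρ x` and `ρ y` would identify a red spoke with a blue one after cancelling `ρ`.
    -- The value `x` would close the rotation at `v` after two darts and miss `y`.
    ρ²x≡y : ρ (ρ x) ≡ y
    ρ²x≡y with all-spokes {ρ (ρ x)} (trans (src-ρ (ρ x)) (trans (src-ρ x) src-x))
    ... | there (there (here p))         = p
    ... | there (here p)                 = contradiction (sym (ρ-injective p)) (red≢ red-x blue-x)
    ... | there (there (there (here p))) = contradiction (sym (ρ-injective p)) (red≢ red-y blue-x)
    ... | here ρ²x≡x with Equivalence.to (src-orbits x y) (trans src-x (sym src-y))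
    ...   | k , p with period-two k x ρ²x≡x p
      where
      period-two : ∀ k z → ρ (ρ z) ≡ z → iterate ρ z k ≡ y → y ≡ z ⊎ y ≡ ρ z
      period-two zero    z _ refl = inj₁ refl
      period-two (suc k) z q p with period-two k (ρ z) (cong ρ q) p
      ... | inj₁ r = inj₂ r
      ... | inj₂ r = inj₁ (trans r q)
    ...     | inj₁ y≡x  = contradiction (sym y≡x) x≢y
    ...     | inj₂ y≡ρx = contradiction y≡ρx (red≢ red-y blue-x)

  -- Recolouring a vertex without creating blue cycles.

  recolour : Colouring → Vertex → Colouring
  recolour col v u with u Fin.≟ v
  ... | yes _ = blue
  ... | no  _ = col u

  recolour-at : ∀ col v → recolour col v v ≡ blue
  recolour-at col v with v Fin.≟ v
  ... | yes _  = refl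
  ... | no v≢v = contradiction refl v≢v

  recolour-off : ∀ col {u v} → u ≢ v → recolour col v u ≡ col u
  recolour-off col {u} {v} u≢v with u Fin.≟ v
  ... | yes u≡v = contradiction u≡v u≢v
  ... | no _    = refl

  recolour-red : ∀ col v {u} → recolour col v u ≡ red → col u ≡ red
  recolour-red col v {u} p with u Fin.≟ v
  ... | no _ = p

  module Recolour {col : Colouring} (no-red : NoRedFace col) (forest : BlueForest col)
                  {W} (W-flow : Flow W) (W-red : SupportedOn col red W)
                  {v x y} (opposite : OppositeReds col v x y) (Wy≢0 : W y ≢ 0ℤ) where
    open OppositeReds opposite
    open Degree4 no-red opposite

    col′ : Colouring
    col′ = recolour col v

    -- The aim is that a flow `Z` which is blue after the recolouring vanishes on all four spokes,
    -- hence was blue before. `Φ` is a potential for `Z` as provided by `exactness`.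
    module _ {Z} (Z-flow : Flow Z) (Z-blue : SupportedOn col′ blue Z)
             n Φ (n≢0 : n ≢ 0ℤ) (nZ+∂Φ≡0 : ∀ a → n * Z a + ∂ Φ a ≡ 0ℤ) where

      Z≡0⇒∂Φ≡0 : ∀ {a} → Z a ≡ 0ℤ → ∂ Φ a ≡ 0ℤ
      Z≡0⇒∂Φ≡0 {a} Za≡0 = trans (sym (trans (cong (λ z → n * z + ∂ Φ a) Za≡0) (lemma n (∂ Φ a)))) (nZ+∂Φ≡0 a)
        where
        lemma : ∀ n p → n * 0ℤ + p ≡ p
        lemma = solve-∀

      red-src⇒Z≡0 : ∀ {a} → src a ≢ v → col (src a) ≡ red → Z a ≡ 0ℤ
      red-src⇒Z≡0 {a} src≢v red-src = decidable-stable (Z a ℤ.≟ 0ℤ) λ Za≢0 →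
        red≢blue (trans (sym red-src) (trans (sym (recolour-off col src≢v)) (Z-blue a Za≢0)))

      red-tgt⇒Z≡0 : ∀ {a} → tgt a ≢ v → col (tgt a) ≡ red → Z a ≡ 0ℤ
      red-tgt⇒Z≡0 {a} tgt≢v red-tgt = decidable-stable (Z a ℤ.≟ 0ℤ) λ Za≢0 →
        support-rev Z-flow Za≢0 (red-src⇒Z≡0 tgt≢v red-tgt)

      tgt≢v : ∀ {d} → src d ≡ v → tgt d ≢ v
      tgt≢v {d} src-d tgt-d = no-loops d (trans src-d (sym tgt-d))

      Zx≡0 : Z x ≡ 0ℤ
      Zx≡0 = red-tgt⇒Z≡0 (tgt≢v src-x) red-x

      Zy≡0 : Z y ≡ 0ℤ
      Zy≡0 = red-tgt⇒Z≡0 (tgt≢v src-y) red-y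

      -- Both ends of such a dart are red in `col`, and one of them differs from `v`, so it is still
      -- red in `col′`.
      W⇒Z≡0 : ∀ {a} → W a ≢ 0ℤ → Z a ≡ 0ℤ
      W⇒Z≡0 {a} Wa≢0 with src a Fin.≟ v
      ... | yes src≡v = red-tgt⇒Z≡0 (tgt≢v src≡v) (support-tgt {col} W-flow W-red a Wa≢0)
      ... | no  src≢v = red-src⇒Z≡0 src≢v (W-red a Wa≢0)

      -- Pairing the darts a and rev a turns twice the sum into the pairing of ∂ Φ, a
      -- multiple of Z, with W.
      ΣΦW≡0 : sum (λ a → Φ (left a) * W a) ≡ 0ℤ
      ΣΦW≡0 = double-zero (begin
        sum ΦW + sum ΦW                    ≡⟨ cong (sum ΦW +_) (sum-rev ΦW) ⟩
        sum ΦW + sum (ΦW ∘ rev)            ≡⟨ ∑-distrib-+ ΦW _ ⟨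
        sum (λ a → ΦW a + ΦW (rev a))      ≡⟨ sum-zero pointwise ⟩
        0ℤ                                 ∎)
        where
        open ≡-Reasoning
        ΦW : Dart → ℤ
        ΦW a = Φ (left a) * W a
        double-zero : ∀ {i} → i + i ≡ 0ℤ → i ≡ 0ℤ
        double-zero {i} p = [ (λ ()) , id ]′ (ℤ.i*j≡0⇒i≡0∨j≡0 (pos 2) (trans (lemma i) p))
          where
          lemma : ∀ i → pos 2 * i ≡ i + i
          lemma = solve-∀
        collect : ∀ p q w → p * w + q * - w ≡ (p - q) * w
        collect = solve-∀
        pointwise : ∀ a → ΦW a + ΦW (rev a) ≡ 0ℤ
        pointwise a = trans (cong (λ w → ΦW a + Φ (left (rev a)) * w) (antisymmetric W-flow a))
                        (trans (collect (Φ (left a)) (Φ (left (rev a))) (W a)) (∂Φ*W≡0 (W a ℤ.≟ 0ℤ)))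
          where
          ∂Φ*W≡0 : Dec (W a ≡ 0ℤ) → ∂ Φ a * W a ≡ 0ℤ
          ∂Φ*W≡0 (yes p) = trans (cong (∂ Φ a *_) p) (ℤ.*-zeroʳ (∂ Φ a))
          ∂Φ*W≡0 (no  p) = cong (_* W a) (Z≡0⇒∂Φ≡0 (W⇒Z≡0 p))

      -- The value of `Φ` around a vertex, meaningful where `Φ` is constant around it. At `v` this
      -- may fail, and the face of `x` is chosen to make the term of `x` in `Φy≡Φx` vanish.
      Φ-at : Vertex → ℤ
      Φ-at u with u Fin.≟ v
      ... | yes _ = Φ (left x)
      ... | no  _ = Φ (left (proj₁ (dart-at u)))

      Φ-at-v : Φ-at v ≡ Φ (left x)
      Φ-at-v with v Fin.≟ v
      ... | yes _  = refl
      ... | no v≢v = contradiction refl v≢v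

      Φ-at-red : ∀ {a} → src a ≢ v → col (src a) ≡ red → Φ-at (src a) ≡ Φ (left a)
      Φ-at-red {a} src≢v red-src with src a Fin.≟ v
      ... | yes src≡v = contradiction src≡v src≢v
      ... | no  _     = constant-around Φ {src a} (λ b same → a-b≡0⇒a≡b (Z≡0⇒∂Φ≡0
          (red-src⇒Z≡0 (src≢v ∘ trans (sym same)) (trans (cong col same) red-src))))
        (proj₂ (dart-at (src a))) refl

      -- Φ is constant around every red vertex but v, so by the balance of W only the
      -- two red darts x and y at v contribute to the sum above.
      Φy≡Φx : Φ (left y) ≡ Φ (left x)
      Φy≡Φx = a-b≡0⇒a≡b ([ id , (λ p → contradiction p Wy≢0) ]′ (ℤ.i*j≡0⇒i≡0∨j≡0 (Φ (left y) - Φ (left x)) (begin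
        (Φ (left y) - Φ (left x)) * W y
          ≡⟨ cong (λ p → (Φ (left y) - p) * W y) (trans (cong Φ-at src-y) Φ-at-v) ⟨
        (Φ (left y) - Φ-at (src y)) * W y
          ≡⟨ sum-single {t = λ a → (Φ (left a) - Φ-at (src a)) * W a} y others ⟨
        sum (λ a → (Φ (left a) - Φ-at (src a)) * W a)
          ≡⟨ sum-cong-≗ (λ a → expand (Φ (left a)) (Φ-at (src a)) (W a)) ⟩
        sum (λ a → Φ (left a) * W a - Φ-at (src a) * W a)
          ≡⟨ sum-difference (λ a → Φ (left a) * W a) _ ⟩
        sum (λ a → Φ (left a) * W a) - sum (λ a → Φ-at (src a) * W a)
          ≡⟨ cong₂ _-_ ΣΦW≡0 (balanced W-flow Φ-at) ⟩
        0ℤ ∎)))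
        where
        open ≡-Reasoning
        expand : ∀ a b c → (a - b) * c ≡ a * c - b * c
        expand = solve-∀
        vanish : ∀ {a} → Φ (left a) ≡ Φ-at (src a) → (Φ (left a) - Φ-at (src a)) * W a ≡ 0ℤ
        vanish {a} p = cong (_* W a) (trans (cong (λ q → q - Φ-at (src a)) p) (ℤ.+-inverseʳ (Φ-at (src a))))
        others : ∀ a → a ≢ y → (Φ (left a) - Φ-at (src a)) * W a ≡ 0ℤ
        others a a≢y = go (W a ℤ.≟ 0ℤ) (src a Fin.≟ v)
          where
          go : Dec (W a ≡ 0ℤ) → Dec (src a ≡ v) → (Φ (left a) - Φ-at (src a)) * W a ≡ 0ℤ
          go (yes p)    _           = trans (cong ((Φ (left a) - Φ-at (src a)) *_) p) (ℤ.*-zeroʳ (Φ (left a) - Φ-at (src a)))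
          go (no  Wa≢0) (no  src≢v) = vanish {a} (sym (Φ-at-red src≢v (W-red a Wa≢0)))
          go (no  Wa≢0) (yes src≡v) with all-spokes src≡v
          -- Among the spokes, `x` contributes nothing by the choice of `Φ-at v`, and `ρ x` and
          -- `ρ y` lead to blue vertices, where `W` is zero.
          ... | here refl                         = vanish {a} (sym (trans (cong Φ-at src-x) Φ-at-v))
          ... | there (here p)                    = contradiction p (red≢ (support-tgt {col} W-flow W-red a Wa≢0) blue-x)
          ... | there (there (here p))            = contradiction p a≢y
          ... | there (there (there (here p)))    = contradiction p (red≢ (support-tgt {col} W-flow W-red a Wa≢0) blue-y)

      -- The spoke `ρ x` separates the right side of `x`, where `Φ` is the same as on the left of
      -- `x`, from the left side of `y`, since `ρ (ρ x)` is `y`.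
      Zρx≡0 : Z (ρ x) ≡ 0ℤ
      Zρx≡0 = [ (λ p → contradiction p n≢0) , id ]′ (ℤ.i*j≡0⇒i≡0∨j≡0 n (begin
        n * Z (ρ x)                      ≡⟨ ℤ.+-identityʳ _ ⟨
        n * Z (ρ x) + 0ℤ                 ≡⟨ cong (n * Z (ρ x) +_) ∂Φρx≡0 ⟨
        n * Z (ρ x) + ∂ Φ (ρ x)          ≡⟨ nZ+∂Φ≡0 (ρ x) ⟩
        0ℤ                               ∎))
        where
        open ≡-Reasoning
        ∂Φρx≡0 : ∂ Φ (ρ x) ≡ 0ℤ
        ∂Φρx≡0 = trans (cong₂ _-_
          (trans (cong Φ (left-ρ x)) (sym (a-b≡0⇒a≡b {Φ (left x)} {Φ (left (rev x))} (Z≡0⇒∂Φ≡0 Zx≡0))))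
          (trans (cong Φ (trans (sym (left-ρ (ρ x))) (cong left ρ²x≡y))) Φy≡Φx))
          (ℤ.+-inverseʳ (Φ (left x)))

      -- This is the last spoke, and a flow cannot be nonzero on just one dart at `v`.
      Zρy≡0 : Z (ρ y) ≡ 0ℤ
      Zρy≡0 = decidable-stable (Z (ρ y) ℤ.≟ 0ℤ) λ Zρy≢0 →
        let b , src≡ , b≢ρy , Zb≢0 = other-support Z-flow Zρy≢0
        in Zb≢0 (except (all-spokes (trans src≡ (trans (src-ρ y) src-y))) b≢ρy)
        where
        except : ∀ {b} → b ∈ spokes → b ≢ ρ y → Z b ≡ 0ℤ
        except (here refl)                         _ = Zx≡0
        except (there (here refl))                 _ = Zρx≡0
        except (there (there (here refl)))         _ = Zy≡0
        except (there (there (there (here refl)))) q = contradiction refl q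

      Z-blue-before : SupportedOn col blue Z
      Z-blue-before a Za≢0 with src a Fin.≟ v
      ... | yes src≡v = contradiction (All.lookup {P = λ b → Z b ≡ 0ℤ} (Zx≡0 ∷ Zρx≡0 ∷ Zy≡0 ∷ Zρy≡0 ∷ []) (all-spokes src≡v)) Za≢0
      ... | no  src≢v = trans (sym (recolour-off col src≢v)) (Z-blue a Za≢0)

    forest′ : BlueForest col′
    forest′ Z-flow Z-blue =
      let n , Φ , n≢0 , nZ+∂Φ≡0 = exactness Z-flow
      in forest Z-flow (Z-blue-before Z-flow Z-blue n Φ n≢0 nZ+∂Φ≡0)

  -- Induction on the set of red vertices.

  redSet : Colouring → Subset #V
  redSet col = Vec.tabulate (isRed ∘ col)

  ∈-redSet⁺ : ∀ {col u} → col u ≡ red → u ∈ˢ redSet col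
  ∈-redSet⁺ {col} {u} p = Vec.lookup⇒[]= u (redSet col) (trans (Vec.lookup∘tabulate (isRed ∘ col) u) (cong isRed p))

  ∈-redSet⁻ : ∀ {col u} → u ∈ˢ redSet col → col u ≡ red
  ∈-redSet⁻ {col} {u} p = isRed⁻¹ (trans (sym (Vec.lookup∘tabulate (isRed ∘ col) u)) (Vec.[]=⇒lookup p))

  redSet-shrinks : ∀ {col v} → col v ≡ red → redSet (recolour col v) ⊂ redSet col
  redSet-shrinks {col} {v} red-v =
    (λ p → ∈-redSet⁺ {col} (recolour-red col v (∈-redSet⁻ {recolour col v} p))) ,
    v , ∈-redSet⁺ {col} red-v , λ p → red≢blue (trans (sym (∈-redSet⁻ {recolour col v} p)) (recolour-at col v))

  -- Red vertices after recolouring were red before, so the conditions on red faces and red cycles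
  -- are inherited; only `BlueForest` needs `Recolour.forest′`.
  hamiltonian : ∀ col → Acc _⊂_ (redSet col) → NoRedFace col → BlueForest col → RedCyclesHaveDegree≤4 col → Graph.Hamiltonian dual
  hamiltonian col (acc rec) no-red forest short with Crossings.hamiltonian-or-red-flow col no-red forest
  ... | inj₁ ham = ham
  ... | inj₂ (W , a , W-flow , W-red , Wa≢0)
    with support-cycle W-flow Wa≢0
  ... | C , C⊆
    with find (short C (All.tabulate λ u∈C → let b , src≡ , Wb≢0 = C⊆ u∈C in subst (λ u → col u ≡ red) src≡ (W-red b Wb≢0)))
  ... | v , v∈C , degree≤
    with C⊆ v∈C
  ... | x , src-x , Wx≢0
    with other-support W-flow Wx≢0
  -- The flow `W` leaves `v` along a second dart, which supplies the other red neighbour.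
  ... | y , src-y , y≢x , Wy≢0 =
    hamiltonian (recolour col v) (rec (redSet-shrinks red-v))
      (λ a → no-red a ∘ All.map (recolour-red col v))
      (Recolour.forest′ no-red forest W-flow W-red opposite Wy≢0)
      (λ C → short C ∘ All.map (recolour-red col v))
    where
    red-v : col v ≡ red
    red-v = subst (λ u → col u ≡ red) src-x (W-red x Wx≢0)
    opposite : OppositeReds col v x y
    opposite = record
      { src-x = src-x ; src-y = trans src-y src-x ; x≢y = ≢-sym y≢x ; red-v = red-v
      ; red-x = support-tgt {col} W-flow W-red x Wx≢0 ; red-y = support-tgt {col} W-flow W-red y Wy≢0
      ; degree≤ = degree≤ }

theorem1 : (T : PlanarTriangulation) → let open PlanarTriangulation T in
    (colour : Vertex → Colour) →
    (∀ (f : Face) → ∃[ v ] (Incident v f × colour v ≡ blue)) →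
    ¬ (∃[ C ] All (λ v → colour v ≡ blue) (Cycle.vertices C)) →
    (∀ (C : Cycle) → All (λ v → colour v ≡ red) (Cycle.vertices C) → Any (λ v → degree v ≤ 4) (Cycle.vertices C)) →
    Graph.Hamiltonian dual
theorem1 T colour blue-on-face no-blue-cycle short =
  hamiltonian colour (⊂-wellFounded _) no-red (no-blue-cycle⇒BlueForest no-blue-cycle) short
  where
  open Triangulation T
  no-red : NoRedFace colour
  no-red a all-red with blue-on-face (left a)
  ... | _ , (b , left≡ , refl) , blue-b = red≢blue (trans (sym (All.lookup all-red (src∈corners (sym left≡)))) blue-b)
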